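{- Assume the constraint theory $CT$ allows the built-in predicate $=$ and the signature contains at least a constant symbol and a function symbol of arity $>0$. Let $\mathcal{G}$ be a class of goals such that if $H$ is a head of a rule then $K\in\mathcal{G}$ for any $K\subseteq H$ (multiset inclusion). Then, for $n\ge 2$, there exists no acceptable encoding of $\mathrm{CHR}_{n,d}$ in $\mathrm{CHR}_1$ for the class $\mathcal{G}$.
   Context: **CHR.** Fix a signature whose predicate symbols are split into two disjoint sets $\Pi_b$ (built-in) and $\Pi_u$ (user-defined), and a first-order theory $CT$ giving the meaning of built-ins. Built-in constraints are given by $c::=a\mid c\wedge c\mid\exists_x c$ with $a$ an atomic formula over $\Pi_b$; a user-defined constraint is an atomic formula over $\Pi_u$. Conjunctions of atomic constraints are treated as multisets; "," denotes conjunction (multiset union); ${\tt true}$ is the empty multiset of built-in constraints. $Fv(\phi)$ is the set of free variables of $\phi$, and $\exists_{ -V}\phi$ is the existential closure of $\phi$ except for the variables in $V$. $p(\bar t)=p(\bar t')$ denotes the componentwise equalities $\bar t=\bar t'$ (undefined for different predicate symbols), extended in the expected way to multisets of constraints. A simplification rule has the form $H\Leftrightarrow C\mid B$ and a propagation rule the form $H\Rightarrow C\mid B$, where the head $H$ is a nonempty multiset of user-defined constraints, the guard $C$ a multiset of built-in constraints, and the body $B$ a multiset of constraints of both kinds. A program is a finite set of rules; a goal is a multiset of constraints of both kinds. Configurations are triples $\langle G,K,d\rangle$ ($G$ the constraints still to be solved, $K$ the accumulated user-defined constraints, $d$ a built-in constraint). For a program $P$, the relation $\longrightarrow$ is the least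 one such that: - Solve: $\langle (c,G),K,d\rangle\longrightarrow\langle G,K,d'\rangle$ if $c$ is built-in and $CT\models c\wedge d\leftrightarrow d'$; - Introduce: $\langle (h,G),K,d\rangle\longrightarrow\langle G,(h,K),d\rangle$ if $h$ is user-defined; - Simplify: $\langle G,H'\wedge K,d\rangle\longrightarrow\langle B\wedge G,K,H=H'\wedge d\rangle$ if $(H\Leftrightarrow C\mid B)\in P$, $x=Fv(H)$ and $CT\models d\rightarrow\exists_x((H=H')\wedge C)$; - Propagate: $\langle G,H'\wedge K,d\rangle\longrightarrow\langle B\wedge G,H'\wedge K,H=H'\wedge d\rangle$ if $(H\Rightarrow C\mid B)\in P$, $x=Fv(H)$ and $CT\models d\rightarrow\exists_x((H=H')\wedge C)$. In Simplify and Propagate the program rule is renamed with fresh variables. The data sufficient answers of $G$ in $P$ are $$\mathcal{SA}_P(G)=\{\exists_{ -Fv(G)}d\mid\langle G,\emptyset,\emptyset\rangle\longrightarrow^*\langle\emptyset,\emptyset,d\rangle\not\longrightarrow\}.$$ Answers are read up to logical equivalence under $CT$. A data sufficient answer for the goal $G$ in $P$ is trivial if it is equal to $G$, and non trivial otherwise. **Dialects.** $\mathrm{CHR}_n$ is the CHR language where the number of atoms in the head of each rule is at most $n$. $\mathrm{CHR}_{n,d}$ consists of the $\mathrm{CHR}_n$ programs which have (for some goal) non trivial data sufficient answers. **Acceptable encodings.** For a CHR (sub)language $\mathrm{CHR}_x$ let $\mathcal{P}_x$ be the set of its programs and $\mathcal{G}_x$ the set of its possible goals (the user-defined predicates of source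 and target languages may differ). An acceptable encoding of $\mathrm{CHR}_x$ into $\mathrm{CHR}_y$ for the class of goals $\mathcal{G}$ is a pair of mappings $[\![\ ]\!]:\mathcal{P}_x\to\mathcal{P}_y$ and $[\![\ ]\!]_g:\mathcal{G}_x\to\mathcal{G}_y$ such that: (1) $\mathcal{P}_x$ and $\mathcal{P}_y$ share the same $CT$; (2) for any goal $(A,B)\in\mathcal{G}_x$, $[\![A,B]\!]_g=[\![A]\!]_g,[\![B]\!]_g$, and the built-ins present in the goal are left unchanged; (3) for all $P\in\mathcal{P}_x$ and $G\in\mathcal{G}$, $\mathcal{SA}_P(G)=\mathcal{SA}_{[\![P]\!]}([\![G]\!]_g)$. -}

module Defs where

open import Level using (Level; 0ℓ; _⊔_) renaming (suc to lsuc)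
open import Data.Bool.Base using (if_then_else_)
open import Data.Empty using (⊥)
open import Data.List.Base using (List; []; _∷_; _++_; map; concatMap; filter; foldr; length)
open import Data.List.NonEmpty.Base using (List⁺; toList) renaming (map to map⁺)
open import Data.List.Membership.Propositional using (_∈_)
open import Data.List.Relation.Binary.Disjoint.Propositional using (Disjoint)
open import Data.List.Relation.Binary.Permutation.Propositional using (_↭_)
open import Data.List.Relation.Unary.All using (All)
open import Data.List.Relation.Unary.Any using (Any)
open import Data.Nat.Base using (ℕ; _≤_)
open import Data.Nat.Properties using (_≟_)
open import Data.List.Membership.DecPropositional _≟_ using (_∉?_)
open import Data.Product.Base using (Σ; ∃; ∃-syntax; _×_; _,_; proj₁)
open import Data.Sum.Base using (_⊎_)
open import Data.Unit.Base using (⊤)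
open import Data.Vec.Base as Vec using (Vec; []; _∷_)
open import Function.Definitions using (Injective)
open import Relation.Binary.Construct.Closure.ReflexiveTransitive using (Star)
open import Relation.Binary.PropositionalEquality using (_≡_)
open import Relation.Nullary using (¬_; does)
open import Relation.Unary using (Pred)

record RankedSet : Set₁ where
  field
    Symbol : Set
    arity  : Symbol → ℕ

open RankedSet public

-- The function symbols and the built-in predicate symbols.  Equality is a
-- built-in predicate as well, but a logical one (the constructor _≐_ below,
-- always interpreted as identity), so it is not listed in `builtins`.
-- User-defined predicate symbols form a separate RankedSet, as they may vary
-- between languages over the same signature.
record Signature : Set₁ where
  field
    functions : RankedSet
    builtins  : RankedSet

open Signature public

Var : Set
Var = ℕ

------------------------------------------------------------------------
-- First-order logic over the built-ins

data Term (S : Signature) : Set where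
  var : Var → Term S
  fun : (f : Symbol (functions S)) → Vec (Term S) (arity (functions S) f) → Term S

infix 8 _≐_

data BAtom (S : Signature) : Set where
  rel : (b : Symbol (builtins S)) → Vec (Term S) (arity (builtins S) b) → BAtom S
  _≐_ : Term S → Term S → BAtom S

data Formula (S : Signature) : Set where
  atom            : BAtom S → Formula S
  ⊤̇ ⊥̇             : Formula S
  _∧̇_ _∨̇_ _⇒̇_    : Formula S → Formula S → Formula S
  ∀̇ ∃̇             : Var → Formula S → Formula S

infixr 7 _∧̇_
infixr 6 _∨̇_
infixr 5 _⇒̇_
infix  4 _⇔̇_

_⇔̇_ : ∀ {S} → Formula S → Formula S → Formula S
φ ⇔̇ ψ = (φ ⇒̇ ψ) ∧̇ (ψ ⇒̇ φ)

Theory : Signature → Set₁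
Theory S = Pred (Formula S) 0ℓ

record Structure (S : Signature) : Set₁ where
  field
    Carrier    : Set
    inhabitant : Carrier
    ⟦fun⟧      : (f : Symbol (functions S)) → Vec Carrier (arity (functions S) f) → Carrier
    ⟦rel⟧      : (b : Symbol (builtins S)) → Vec Carrier (arity (builtins S) b) → Set

module _ {S : Signature} (M : Structure S) where
  open Structure M

  Valuation : Set
  Valuation = Var → Carrier

  infix 9 _[_↦_]

  _[_↦_] : Valuation → Var → Carrier → Valuation
  (v [ x ↦ a ]) y = if does (x ≟ y) then a else v y

  evalTerm  : Valuation → Term S → Carrier
  evalTerms : ∀ {k} → Valuation → Vec (Term S) k → Vec Carrier k
  evalTerm v (var x)    = v x
  evalTerm v (fun f ts) = ⟦fun⟧ f (evalTerms v ts)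
  evalTerms v []       = []
  evalTerms v (t ∷ ts) = evalTerm v t ∷ evalTerms v ts

  Sat : Valuation → Formula S → Set
  Sat v (atom (rel b ts)) = ⟦rel⟧ b (evalTerms v ts)
  Sat v (atom (s ≐ t))    = evalTerm v s ≡ evalTerm v t
  Sat v ⊤̇                 = ⊤
  Sat v ⊥̇                 = ⊥
  Sat v (φ ∧̇ ψ)           = Sat v φ × Sat v ψ
  Sat v (φ ∨̇ ψ)           = Sat v φ ⊎ Sat v ψ
  Sat v (φ ⇒̇ ψ)           = Sat v φ → Sat v ψ
  Sat v (∀̇ x φ)           = ∀ a → Sat (v [ x ↦ a ]) φ
  Sat v (∃̇ x φ)           = ∃[ a ] Sat (v [ x ↦ a ]) φ

  -- Validity; open formulas are read universally closed.
  Valid : Formula S → Set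
  Valid φ = ∀ v → Sat v φ

infix 3 _⊨_

_⊨_ : ∀ {S} → Theory S → Formula S → Set₁
_⊨_ {S} CT φ = (M : Structure S) → (∀ {ψ} → CT ψ → Valid M ψ) → Valid M φ

------------------------------------------------------------------------
-- Constraints, goals, rules, programs

data Constraint (S : Signature) : Set where
  atom : BAtom S → Constraint S
  _∧ᶜ_ : Constraint S → Constraint S → Constraint S
  ∃ᶜ   : Var → Constraint S → Constraint S

⌊_⌋ : ∀ {S} → Constraint S → Formula S
⌊ atom a ⌋  = atom a
⌊ c ∧ᶜ d ⌋  = ⌊ c ⌋ ∧̇ ⌊ d ⌋
⌊ ∃ᶜ x c ⌋  = ∃̇ x ⌊ c ⌋

-- Multisets are represented by lists, and used only up to _↭_.  A Store is a
-- multiset of built-in constraints; the empty one is `true`.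
Store : Signature → Set
Store S = List (Constraint S)

⋀ : ∀ {S} → Store S → Formula S
⋀ = foldr (λ c φ → ⌊ c ⌋ ∧̇ φ) ⊤̇

data UAtom (S : Signature) (U : RankedSet) : Set where
  _·_ : (p : Symbol U) → Vec (Term S) (arity U p) → UAtom S U

data Literal (S : Signature) (U : RankedSet) : Set where
  builtin : Constraint S → Literal S U
  user    : UAtom S U → Literal S U

Goal : Signature → RankedSet → Set
Goal S U = List (Literal S U)

data Kind : Set where
  simplification propagation : Kind

record Rule (S : Signature) (U : RankedSet) : Set where
  constructor rule
  field
    kind  : Kind
    head⁺ : List⁺ (UAtom S U)
    guard : Store S
    body  : Goal S U

  head : List (UAtom S U)
  head = toList head⁺

open Rule public

-- Programs are finite sets of rules; see _≋_ below for their equality.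
Program : Signature → RankedSet → Set
Program S U = List (Rule S U)

------------------------------------------------------------------------
-- Free variables (as lists, possibly with repetitions)

module _ {S : Signature} where

  fvTerm  : Term S → List Var
  fvTerms : ∀ {k} → Vec (Term S) k → List Var
  fvTerm (var x)    = x ∷ []
  fvTerm (fun f ts) = fvTerms ts
  fvTerms []       = []
  fvTerms (t ∷ ts) = fvTerm t ++ fvTerms ts

  fvBAtom : BAtom S → List Var
  fvBAtom (rel b ts) = fvTerms ts
  fvBAtom (s ≐ t)    = fvTerm s ++ fvTerm t

  infixl 6 _∖_

  _∖_ : List Var → List Var → List Var
  xs ∖ ys = filter (_∉? ys) xs

  fvFormula : Formula S → List Var
  fvFormula (atom a) = fvBAtom a
  fvFormula ⊤̇        = []
  fvFormula ⊥̇        = []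
  fvFormula (φ ∧̇ ψ)  = fvFormula φ ++ fvFormula ψ
  fvFormula (φ ∨̇ ψ)  = fvFormula φ ++ fvFormula ψ
  fvFormula (φ ⇒̇ ψ)  = fvFormula φ ++ fvFormula ψ
  fvFormula (∀̇ x φ)  = fvFormula φ ∖ (x ∷ [])
  fvFormula (∃̇ x φ)  = fvFormula φ ∖ (x ∷ [])

  fvStore : Store S → List Var
  fvStore d = fvFormula (⋀ d)

  ∃* : List Var → Formula S → Formula S
  ∃* xs φ = foldr ∃̇ φ xs

  ∃₋ : List Var → Formula S → Formula S
  ∃₋ V φ = ∃* (fvFormula φ ∖ V) φ

module _ {S : Signature} {U : RankedSet} where

  fvUAtom : UAtom S U → List Var
  fvUAtom (p · ts) = fvTerms ts

  fvUAtoms : List (UAtom S U) → List Var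
  fvUAtoms = concatMap fvUAtom

  fvLiteral : Literal S U → List Var
  fvLiteral (builtin c) = fvFormula ⌊ c ⌋
  fvLiteral (user h)    = fvUAtom h

  fvGoal : Goal S U → List Var
  fvGoal = concatMap fvLiteral

  fvRule : Rule S U → List Var
  fvRule r = fvUAtoms (head r) ++ fvStore (guard r) ++ fvGoal (body r)

------------------------------------------------------------------------
-- Renaming of rules.  Renamings are applied to bound variables too, which is
-- capture-avoiding because only injective renamings are used.

module _ {S : Signature} (σ : Var → Var) where

  renTerm  : Term S → Term S
  renTerms : ∀ {k} → Vec (Term S) k → Vec (Term S) k
  renTerm (var x)    = var (σ x)
  renTerm (fun f ts) = fun f (renTerms ts)
  renTerms []       = []
  renTerms (t ∷ ts) = renTerm t ∷ renTerms ts

  renBAtom : BAtom S → BAtom S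
  renBAtom (rel b ts) = rel b (renTerms ts)
  renBAtom (s ≐ t)    = renTerm s ≐ renTerm t

  renConstraint : Constraint S → Constraint S
  renConstraint (atom a)  = atom (renBAtom a)
  renConstraint (c ∧ᶜ d)  = renConstraint c ∧ᶜ renConstraint d
  renConstraint (∃ᶜ x c)  = ∃ᶜ (σ x) (renConstraint c)

module _ {S : Signature} {U : RankedSet} (σ : Var → Var) where

  renUAtom : UAtom S U → UAtom S U
  renUAtom (p · ts) = p · renTerms σ ts

  renLiteral : Literal S U → Literal S U
  renLiteral (builtin c) = builtin (renConstraint σ c)
  renLiteral (user h)    = user (renUAtom h)

  renRule : Rule S U → Rule S U
  renRule (rule k H C B) =
    rule k (map⁺ renUAtom H) (map (renConstraint σ) C) (map renLiteral B)

------------------------------------------------------------------------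
-- Operational semantics

-- `H ≗ H' ↝ E` : the equation H = H' between multisets of user-defined
-- constraints is defined and is the conjunction E.  Atoms are paired in list
-- order; _⟶_ may first reorder the store, so every pairing is covered.
data _≗_↝_ {S : Signature} {U : RankedSet} :
       List (UAtom S U) → List (UAtom S U) → Store S → Set where
  []  : [] ≗ [] ↝ []
  _∷_ : ∀ p {ts ts' H H' E} → H ≗ H' ↝ E →
        (p · ts ∷ H) ≗ (p · ts' ∷ H') ↝
          (Vec.toList (Vec.zipWith (λ t t' → atom (t ≐ t')) ts ts') ++ E)

record Config (S : Signature) (U : RankedSet) : Set where
  constructor ⟨_,_,_⟩
  field
    goal  : Goal S U
    users : List (UAtom S U)
    store : Store S

fvConfig : ∀ {S U} → Config S U → List Var
fvConfig ⟨ G , K , d ⟩ = fvGoal G ++ fvUAtoms K ++ fvStore d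

module _ {S : Signature} (CT : Theory S) {U : RankedSet} (P : Program S U) where

  -- `Instance W k H C B` : a rule of P of kind k, renamed so as to avoid W.
  Instance : List Var → Kind → List (UAtom S U) → Store S → Goal S U → Set
  Instance W k H C B =
    ∃[ r ] ∃[ σ ] r ∈ P × Injective _≡_ _≡_ σ
      × let r' = renRule σ r in
        Disjoint (fvRule r') W × kind r' ≡ k × head r' ≡ H × guard r' ≡ C × body r' ≡ B

  -- W is the set of variables a freshly renamed rule has to avoid.
  data Step (W : List Var) : Config S U → Config S U → Set₁ where

    solve : ∀ {G G' K d d' c} →
      G ↭ builtin c ∷ G' →
      CT ⊨ (⌊ c ⌋ ∧̇ ⋀ d) ⇔̇ ⋀ d' →
      Step W ⟨ G , K , d ⟩ ⟨ G' , K , d' ⟩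

    introduce : ∀ {G G' K d h} →
      G ↭ user h ∷ G' →
      Step W ⟨ G , K , d ⟩ ⟨ G' , h ∷ K , d ⟩

    simplify : ∀ {G K K' d H H' E C B} →
      Instance W simplification H C B →
      K ↭ H' ++ K' →
      H ≗ H' ↝ E →
      CT ⊨ ⋀ d ⇒̇ ∃* (fvUAtoms H) (⋀ (E ++ C)) →
      Step W ⟨ G , K , d ⟩ ⟨ B ++ G , K' , E ++ d ⟩

    propagate : ∀ {G K K' d H H' E C B} →
      Instance W propagation H C B →
      K ↭ H' ++ K' →
      H ≗ H' ↝ E →
      CT ⊨ ⋀ d ⇒̇ ∃* (fvUAtoms H) (⋀ (E ++ C)) →
      Step W ⟨ G , K , d ⟩ ⟨ B ++ G , H' ++ K' , E ++ d ⟩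

  -- Along a derivation a variable is fresh if it is free in no configuration
  -- reached so far; in particular the variables of the initial goal stay
  -- excluded even when a solve step removes them from the store.
  data _⟶_ : List Var × Config S U → List Var × Config S U → Set₁ where
    step : ∀ {W γ γ'} → Step W γ γ' → (W , γ) ⟶ (fvConfig γ' ++ W , γ')

  _⟶*_ : List Var × Config S U → List Var × Config S U → Set₁
  _⟶*_ = Star _⟶_

  data SA (G : Goal S U) : Pred (Formula S) (lsuc 0ℓ) where
    answer : ∀ {W d} →
      (fvGoal G , ⟨ G , [] , [] ⟩) ⟶* (W , ⟨ [] , [] , d ⟩) →
      ¬ (∃[ s ] (W , ⟨ [] , [] , d ⟩) ⟶ s) →
      SA G (∃₋ (fvGoal G) (⋀ d))

-- Equality of sets of answers, answers being read up to equivalence under CT.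
_⊢_≅_ : ∀ {S ℓ} → Theory S → Pred (Formula S) ℓ → Pred (Formula S) ℓ → Set (lsuc 0ℓ ⊔ ℓ)
CT ⊢ X ≅ Y =
  (∀ {φ} → X φ → ∃[ ψ ] Y ψ × (CT ⊨ φ ⇔̇ ψ)) × (∀ {ψ} → Y ψ → ∃[ φ ] X φ × (CT ⊨ φ ⇔̇ ψ))

-- φ is equal to G.  Answers contain no user-defined constraints, so this
-- requires G to consist of built-in constraints only.
Trivial : ∀ {S} → Theory S → ∀ {U} → Goal S U → Formula S → Set₁
Trivial CT G φ = ∃[ cs ] G ↭ map builtin cs × (CT ⊨ φ ⇔̇ ⋀ cs)

------------------------------------------------------------------------
-- Dialects and encodings

module _ {S : Signature} {U : RankedSet} where

  CHR : ℕ → Pred (Program S U) 0ℓ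
  CHR n P = All (λ r → length (head r) ≤ n) P

  CHRᵈ : Theory S → ℕ → Pred (Program S U) (lsuc 0ℓ)
  CHRᵈ CT n P = CHR n P × (∃[ G ] ∃[ φ ] SA CT P G φ × ¬ Trivial CT G φ)

  _≈ʳ_ : Rule S U → Rule S U → Set
  r ≈ʳ s = kind r ≡ kind s × head r ↭ head s × guard r ↭ guard s × body r ↭ body s

  _≋_ : Program S U → Program S U → Set
  P ≋ Q = All (λ r → Any (r ≈ʳ_) Q) P × All (λ s → Any (_≈ʳ s) P) Q

  _⊑_ : List (UAtom S U) → List (UAtom S U) → Set
  K ⊑ H = ∃[ K' ] H ↭ K ++ K'

-- An encoding of the language X over the user-defined predicates U into the
-- language Y over the user-defined predicates V, both with constraint theory
-- CT, for the class of goals 𝒢.  The two congruence fields say that the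
-- mappings are defined on programs and multisets, not on their
-- representations by lists.
record AcceptableEncoding {S : Signature} (CT : Theory S) {U V : RankedSet} {x y g : Level}
    (X : Pred (Program S U) x) (Y : Pred (Program S V) y) (𝒢 : Pred (Goal S U) g)
    : Set (lsuc 0ℓ ⊔ x ⊔ y ⊔ g) where
  field
    ⟦_⟧           : Σ (Program S U) X → Σ (Program S V) Y
    ⟦_⟧ᵍ          : Goal S U → Goal S V
    ⟦⟧-cong       : ∀ P Q → proj₁ P ≋ proj₁ Q → proj₁ ⟦ P ⟧ ≋ proj₁ ⟦ Q ⟧
    ⟦⟧ᵍ-cong      : ∀ {A B} → A ↭ B → ⟦ A ⟧ᵍ ↭ ⟦ B ⟧ᵍ
    compositional : ∀ A B → ⟦ A ++ B ⟧ᵍ ↭ ⟦ A ⟧ᵍ ++ ⟦ B ⟧ᵍ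
    builtins-kept : ∀ cs → ⟦ map builtin cs ⟧ᵍ ↭ map builtin cs
    answers       : ∀ P {G} → 𝒢 G →
                    CT ⊢ SA CT (proj₁ P) G ≅ SA CT (proj₁ ⟦ P ⟧) ⟦ G ⟧ᵍ

{-# OPTIONS --safe #-}
-- A program with single-head rules cannot make two goals cooperate unless the
-- guards fired by one of them depend on constraints posted by the other.  If a
-- successful derivation of A, B ends in a store whose projection to the
-- variables of A, B is valid, no such dependence exists: a valuation satisfying
-- the constraints posted on behalf of A can be changed outside the variables
-- met by the derivation of A so as to satisfy the constraints posted on behalf of B as well.  Hence
-- the derivation is an interleaving of a derivation of A and one of B, and A
-- alone succeeds.  But for a constant c and the program
-- p(c,…,c), p(c,…,c) ⇔ true | true, the goal p(c,…,c), p(c,…,c) has a valid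
-- answer and p(c,…,c) has none.
module Submission where

open import Defs
open import Data.Bool.Base using (true; false; T)
open import Data.Empty using (⊥-elim)
open import Data.List.Base using (List; []; _∷_; _++_; map; length)
open import Data.List.Membership.Propositional using (_∈_; _∉_)
open import Data.List.Membership.Propositional.Properties
  using (∈-++⁺ˡ; ∈-++⁺ʳ; ∈-++⁻; ∈-∃++; ∈-filter⁺; ∈-filter⁻)
open import Data.List.NonEmpty.Base using (_∷_)
open import Data.List.Relation.Binary.Disjoint.Propositional using (Disjoint)
open import Data.List.Relation.Binary.Permutation.Propositional
  using (_↭_; ↭-refl; ↭-sym; ↭-trans; prep)
open import Data.List.Relation.Binary.Permutation.Propositional.Properties
  using (∈-resp-↭; drop-∷; shift; ↭-length; ++-comm; ++-assoc; ¬x∷xs↭[])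
  renaming (map⁺ to map-↭; ++⁺ˡ to ++-↭ˡ; ++⁺ʳ to ++-↭ʳ)
open import Data.List.Relation.Binary.Subset.Propositional using (_⊆_)
open import Data.List.Relation.Binary.Subset.Propositional.Properties
  using (concatMap⁺; ∈-∷⁺ʳ)
open import Data.List.Relation.Unary.All using ([]; _∷_)
import Data.List.Relation.Unary.All as All
open import Data.List.Relation.Unary.Any using (here; there)
open import Data.Nat.Base using (ℕ; suc; _≤_; _<_; _+_; _≡ᵇ_; s≤s)
open import Data.Nat.ListAction using (sum)
open import Data.Nat.ListAction.Properties using (sum-↭)
open import Data.Nat.Properties using (_≟_; +-suc; ≡ᵇ⇒≡; ≡⇒≡ᵇ)
open import Data.List.Membership.DecPropositional _≟_ using (_∈?_; _∉?_)
open import Data.Product.Base using (∃-syntax; _×_; _,_; proj₁; proj₂)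
open import Data.Sum.Base using (_⊎_; inj₁; inj₂; [_,_]′)
open import Data.Unit.Base using (tt)
open import Data.Vec.Base as Vec using (Vec; []; _∷_)
open import Function.Base using (_∘_; id)
open import Level using (Level)
open import Relation.Binary.Construct.Closure.ReflexiveTransitive using (Star; ε; _◅_)
open import Relation.Binary.PropositionalEquality
  using (_≡_; refl; sym; trans; cong; cong₂; subst)
open import Relation.Nullary using (¬_; yes; no)
open import Relation.Unary using (Pred)

private variable
  a  : Level
  A  : Set a
  S  : Signature
  U  : RankedSet

-- Inclusions and permutations of lists.

++-⊆ : {xs ys zs : List A} → xs ⊆ zs → ys ⊆ zs → xs ++ ys ⊆ zs
++-⊆ {xs = xs} xs⊆ ys⊆ = [ xs⊆ , ys⊆ ]′ ∘ ∈-++⁻ xs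

-- Used when a step of the whole takes `z` from one component: the other component, `ys`, stays as
-- it is.
remove-left : {z : A} {xs zs : List A} (ys : List A) → z ∈ xs → xs ++ ys ↭ z ∷ zs →
  ∃[ xs' ] xs ↭ z ∷ xs' × zs ↭ xs' ++ ys
remove-left {z = z} ys z∈xs p with as , bs , refl ← ∈-∃++ z∈xs =
  as ++ bs , shift z as bs ,
  drop-∷ (↭-trans (↭-sym p) (++-↭ʳ ys (shift z as bs)))

-- Valuations

module _ (M : Structure S) where
  open Structure M

  private
    Agree : List Var → Valuation M → Valuation M → Set
    Agree xs v w = ∀ {x} → x ∈ xs → v x ≡ w x

  evalTerm-cong : ∀ t {v w} → Agree (fvTerm t) v w → evalTerm M v t ≡ evalTerm M w t
  evalTerms-cong : ∀ {k} (ts : Vec (Term S) k) {v w} → Agree (fvTerms ts) v w →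
    evalTerms M v ts ≡ evalTerms M w ts
  evalTerm-cong (var x)    e = e (here refl)
  evalTerm-cong (fun f ts) e = cong (⟦fun⟧ f) (evalTerms-cong ts e)
  evalTerms-cong []       e = refl
  evalTerms-cong (t ∷ ts) e =
    cong₂ _∷_ (evalTerm-cong t (e ∘ ∈-++⁺ˡ)) (evalTerms-cong ts (e ∘ ∈-++⁺ʳ (fvTerm t)))

  update-cong : ∀ xs {v w x a} → Agree (_∖_ {S} xs (x ∷ [])) v w →
    Agree xs (_[_↦_] M v x a) (_[_↦_] M w x a)
  -- `does (x ≟ y)` computes to `x ≡ᵇ y`, so the case split is on the latter.
  update-cong xs {x = x} e {y} y∈xs with x ≡ᵇ y in x≢y
  ... | true  = refl
  ... | false =
    e (∈-filter⁺ (_∉? (x ∷ [])) y∈xs λ { (here y≡x) → subst T x≢y (≡⇒≡ᵇ x y (sym y≡x)) })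

  Sat-cong : ∀ φ {v w} → Agree (fvFormula φ) v w → Sat M v φ → Sat M w φ
  Sat-cong (atom (rel b ts)) e s = subst (⟦rel⟧ b) (evalTerms-cong ts e) s
  Sat-cong (atom (t ≐ u)) e s =
    trans (sym (evalTerm-cong t (e ∘ ∈-++⁺ˡ)))
      (trans s (evalTerm-cong u (e ∘ ∈-++⁺ʳ (fvTerm t))))
  Sat-cong ⊤̇ e s = s
  Sat-cong (φ ∧̇ ψ) e (s , t) =
    Sat-cong φ (e ∘ ∈-++⁺ˡ) s , Sat-cong ψ (e ∘ ∈-++⁺ʳ (fvFormula φ)) t
  Sat-cong (φ ∨̇ ψ) e (inj₁ s) = inj₁ (Sat-cong φ (e ∘ ∈-++⁺ˡ) s)
  Sat-cong (φ ∨̇ ψ) e (inj₂ t) = inj₂ (Sat-cong ψ (e ∘ ∈-++⁺ʳ (fvFormula φ)) t)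
  Sat-cong (φ ⇒̇ ψ) e s =
    Sat-cong ψ (e ∘ ∈-++⁺ʳ (fvFormula φ)) ∘ s ∘ Sat-cong φ (sym ∘ e ∘ ∈-++⁺ˡ)
  Sat-cong (∀̇ x φ) e s a = Sat-cong φ (update-cong (fvFormula φ) e) (s a)
  Sat-cong (∃̇ x φ) e (a , s) = a , Sat-cong φ (update-cong (fvFormula φ) e) s

  Sat-∃*-cong : ∀ xs φ {v w} → Agree (fvFormula φ) v w →
    Sat M v (∃* xs φ) → Sat M w (∃* xs φ)
  Sat-∃*-cong [] φ e s = Sat-cong φ e s
  Sat-∃*-cong (x ∷ xs) φ e (a , s) =
    a , Sat-∃*-cong xs φ (update-cong (fvFormula φ) (e ∘ proj₁ ∘ ∈-filter⁻ (_∉? (x ∷ [])))) s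

  -- The quantified variables avoid `V`, so gathering their witnesses into one valuation leaves the
  -- values on `V` alone.
  Sat-∃*⁻ : ∀ V xs φ {v} → (∀ {x} → x ∈ xs → x ∉ V) → Sat M v (∃* xs φ) →
    ∃[ w ] Agree V v w × Sat M w φ
  Sat-∃*⁻ V [] φ {v} _ s = v , (λ _ → refl) , s
  Sat-∃*⁻ V (x ∷ xs) φ {v} xs∉V (a , s)
    with w , e , t ← Sat-∃*⁻ V xs φ (xs∉V ∘ there) s =
    w , (λ {y} y∈V → trans (v≡update y∈V) (e y∈V)) , t
    where
      v≡update : ∀ {y} → y ∈ V → v y ≡ (_[_↦_] M v x a) y
      v≡update {y} y∈V with x ≡ᵇ y in x≡y
      ... | true  = ⊥-elim (xs∉V (here (sym (≡ᵇ⇒≡ x y (subst T (sym x≡y) tt)))) y∈V)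
      ... | false = refl

  Valid-∃* : ∀ xs φ → Valid M φ → Valid M (∃* xs φ)
  Valid-∃* []       φ valid = valid
  Valid-∃* (x ∷ xs) φ valid v = inhabitant , Valid-∃* xs φ valid _

  Sat-++⁺ : ∀ {v} (d : Store S) {e} → Sat M v (⋀ d) → Sat M v (⋀ e) → Sat M v (⋀ (d ++ e))
  Sat-++⁺ []      _       t = t
  Sat-++⁺ (c ∷ d) (s , r) t = s , Sat-++⁺ d r t

  Sat-++⁻ : ∀ {v} (d : Store S) {e} → Sat M v (⋀ (d ++ e)) → Sat M v (⋀ d) × Sat M v (⋀ e)
  Sat-++⁻ []      t = tt , t
  Sat-++⁻ (c ∷ d) (s , r) with s' , t ← Sat-++⁻ d r = (s , s') , t

  -- Glues two valuations: `v` will serve one component together with the rule applied to it, `w`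
  -- everything else.
  override : List Var → Valuation M → Valuation M → Valuation M
  override L v w x with x ∈? L
  ... | yes _ = v x
  ... | no _  = w x

  override-∈ : ∀ L v w → Agree L (override L v w) v
  override-∈ L v w {x} x∈L with x ∈? L
  ... | yes _  = refl
  ... | no x∉L = ⊥-elim (x∉L x∈L)

  override-agree : ∀ L v w {xs} → (∀ {x} → x ∈ xs → x ∈ L → v x ≡ w x) →
    Agree xs (override L v w) w
  override-agree L v w e {x} x∈xs with x ∈? L
  ... | yes x∈L = e x∈xs x∈L
  ... | no _    = refl

-- Free variables

fvStore-++ : (d : Store S) {e : Store S} → fvStore (d ++ e) ⊆ fvStore d ++ fvStore e
fvStore-++ []      x∈ = x∈
fvStore-++ (c ∷ d) {e} =
  ++-⊆ (∈-++⁺ˡ ∘ ∈-++⁺ˡ)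
    (++-⊆ (∈-++⁺ˡ ∘ ∈-++⁺ʳ (fvFormula ⌊ c ⌋)) (∈-++⁺ʳ (fvStore (c ∷ d))) ∘ fvStore-++ d)

fvStore-++ˡ : (d : Store S) {e : Store S} → fvStore d ⊆ fvStore (d ++ e)
fvStore-++ˡ (c ∷ d) =
  ++-⊆ ∈-++⁺ˡ (∈-++⁺ʳ (fvFormula ⌊ c ⌋) ∘ fvStore-++ˡ d)

fvUAtoms-++ : (K : List (UAtom S U)) {L : List (UAtom S U)} →
  fvUAtoms (K ++ L) ⊆ fvUAtoms K ++ fvUAtoms L
fvUAtoms-++ []      x∈ = x∈
fvUAtoms-++ (h ∷ K) {L} =
  ++-⊆ (∈-++⁺ˡ ∘ ∈-++⁺ˡ)
    (++-⊆ (∈-++⁺ˡ ∘ ∈-++⁺ʳ (fvUAtom h)) (∈-++⁺ʳ (fvUAtoms (h ∷ K))) ∘ fvUAtoms-++ K)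

fvGoal-++ : (G : Goal S U) {L : Goal S U} → fvGoal (G ++ L) ⊆ fvGoal G ++ fvGoal L
fvGoal-++ []      x∈ = x∈
fvGoal-++ (h ∷ G) {L} =
  ++-⊆ (∈-++⁺ˡ ∘ ∈-++⁺ˡ)
    (++-⊆ (∈-++⁺ˡ ∘ ∈-++⁺ʳ (fvLiteral h)) (∈-++⁺ʳ (fvGoal (h ∷ G))) ∘ fvGoal-++ G)

fvUAtoms-⊆ : {K L : List (UAtom S U)} → K ⊆ L → fvUAtoms K ⊆ fvUAtoms L
fvUAtoms-⊆ = concatMap⁺ fvUAtom

fvGoal-⊆ : {G L : Goal S U} → G ⊆ L → fvGoal G ⊆ fvGoal L
fvGoal-⊆ = concatMap⁺ fvLiteral

open Config

module _ {γ : Config S U} where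

  goal⊆ : fvGoal (goal γ) ⊆ fvConfig γ
  goal⊆ = ∈-++⁺ˡ

  users⊆ : fvUAtoms (users γ) ⊆ fvConfig γ
  users⊆ = ∈-++⁺ʳ (fvGoal (goal γ)) ∘ ∈-++⁺ˡ

  store⊆ : fvStore (store γ) ⊆ fvConfig γ
  store⊆ = ∈-++⁺ʳ (fvGoal (goal γ)) ∘ ∈-++⁺ʳ (fvUAtoms (users γ))

  fvConfig-⊆ : ∀ {X} → fvGoal (goal γ) ⊆ X → fvUAtoms (users γ) ⊆ X → fvStore (store γ) ⊆ X →
    fvConfig γ ⊆ X
  fvConfig-⊆ g k d = ++-⊆ g (++-⊆ k d)

fv-equations : ∀ {k} (ts ts' : Vec (Term S) k) (E : Store S) →
  fvStore (Vec.toList (Vec.zipWith (λ t t' → atom (t ≐ t')) ts ts') ++ E)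
    ⊆ (fvTerms ts ++ fvTerms ts') ++ fvStore E
fv-equations []       []         E x∈ = x∈
fv-equations (t ∷ ts) (t' ∷ ts') E =
  ++-⊆ (++-⊆ {xs = fvTerm t} {ys = fvTerm t'} (∈-++⁺ˡ ∘ ∈-++⁺ˡ ∘ ∈-++⁺ˡ)
             (∈-++⁺ˡ ∘ ∈-++⁺ʳ (fvTerms (t ∷ ts)) ∘ ∈-++⁺ˡ))
    (++-⊆ (++-⊆ {xs = fvTerms ts} {ys = fvTerms ts'} (∈-++⁺ˡ ∘ ∈-++⁺ˡ ∘ ∈-++⁺ʳ (fvTerm t))
                (∈-++⁺ˡ ∘ ∈-++⁺ʳ (fvTerms (t ∷ ts)) ∘ ∈-++⁺ʳ (fvTerm t')))
          (∈-++⁺ʳ (fvTerms (t ∷ ts) ++ fvTerms (t' ∷ ts')))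
     ∘ fv-equations ts ts' E)

fv-≗ : {H H' : List (UAtom S U)} {E : Store S} → H ≗ H' ↝ E →
  fvStore E ⊆ fvUAtoms H ++ fvUAtoms H'
fv-≗ [] ()
fv-≗ (_∷_ p {ts} {ts'} {H} {H'} {E} e) =
  ++-⊆ (++-⊆ {xs = fvTerms ts} {ys = fvTerms ts'} (∈-++⁺ˡ ∘ ∈-++⁺ˡ) (∈-++⁺ʳ (fvUAtoms (p · ts ∷ H)) ∘ ∈-++⁺ˡ))
       (++-⊆ (∈-++⁺ˡ ∘ ∈-++⁺ʳ (fvTerms ts))
             (∈-++⁺ʳ (fvUAtoms (p · ts ∷ H)) ∘ ∈-++⁺ʳ (fvTerms ts')) ∘ fv-≗ e)
  ∘ fv-equations ts ts' E

-- Derivations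

module _ (CT : Theory S) {U : RankedSet} (P : Program S U) where

  State : Set
  State = List Var × Config S U

  _↠_ : State → State → Set₁
  _↠_ = _⟶_ CT P

  -- The two kinds of rule application differ only in the matched atoms that stay, so a function of
  -- the kind lets one argument treat both.
  kept : Kind → List (UAtom S U) → List (UAtom S U)
  kept simplification H' = []
  kept propagation    H' = H'

  apply : ∀ {W k G K K' d H H' E C B} →
    Instance CT P W k H C B →
    K ↭ H' ++ K' →
    H ≗ H' ↝ E →
    CT ⊨ ⋀ d ⇒̇ ∃* (fvUAtoms H) (⋀ (E ++ C)) →
    Step CT P W ⟨ G , K , d ⟩ ⟨ B ++ G , kept k H' ++ K' , E ++ d ⟩
  apply {k = simplification} = simplify
  apply {k = propagation}    = propagate

  -- Every step takes a literal from the goal or matches a head, and heads are nonempty. Hence a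
  -- component that runs empty has an answer, whatever its store.
  empty-final : ∀ {W d} → ¬ (∃[ s ] (W , ⟨ [] , [] , d ⟩) ↠ s)
  empty-final (_ , step (solve p _))   = ¬x∷xs↭[] (↭-sym p)
  empty-final (_ , step (introduce p)) = ¬x∷xs↭[] (↭-sym p)
  empty-final (_ , step (simplify (rule _ ((_ · _) ∷ _) _ _ , _ , _ , _ , _ , _ , refl , _) p (_ ∷ _) _)) =
    ¬x∷xs↭[] (↭-sym p)
  empty-final (_ , step (propagate (rule _ ((_ · _) ∷ _) _ _ , _ , _ , _ , _ , _ , refl , _) p (_ ∷ _) _)) =
    ¬x∷xs↭[] (↭-sym p)

  -- Validity of the projection of `d` to `V` in all models of `CT`, stated with the witnesses
  -- gathered into one valuation.
  Solvable : List Var → Store S → Set₁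
  Solvable V d = (M : Structure S) → (∀ {ψ} → CT ψ → Valid M ψ) → (v : Valuation M) →
    ∃[ w ] (∀ {x} → x ∈ V → v x ≡ w x) × Sat M w (⋀ d)

  valid⇒solvable : ∀ V d → CT ⊨ ∃₋ V (⋀ d) → Solvable V d
  valid⇒solvable V d valid M m v =
    Sat-∃*⁻ M V _ (⋀ d) (proj₂ ∘ ∈-filter⁻ (_∉? V) {xs = fvFormula (⋀ d)}) (valid M m v)

  store-antitone : ∀ {W γ γ'} → Step CT P W γ γ' →
    CT ⊨ ⋀ (store γ') ⇒̇ ⋀ (store γ)
  store-antitone (solve _ eqv) M m v s       = proj₂ (proj₂ (eqv M m v) s)
  store-antitone (introduce _) M m v s       = s
  store-antitone (simplify {E = E} _ _ _ _)  M m v s = proj₂ (Sat-++⁻ M E s)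
  store-antitone (propagate {E = E} _ _ _ _) M m v s = proj₂ (Sat-++⁻ M E s)

  -- Solvability is known at the end of a derivation but used at each step. It travels backwards
  -- because every store implies the earlier ones.
  solvable-start : ∀ {V s s'} → Star _↠_ s s' →
    Solvable V (store (proj₂ s')) → Solvable V (store (proj₂ s))
  solvable-start ε sol = sol
  solvable-start (step r ◅ rs) sol M m v
    with w , e , t ← solvable-start rs sol M m v = w , e , store-antitone r M m w t

  weaken : ∀ {W W' k H C B} → W' ⊆ W → Instance CT P W k H C B → Instance CT P W' k H C B
  weaken W'⊆W (r , σ , r∈P , inj , fresh , rest) =
    r , σ , r∈P , inj , (λ (p , q) → fresh (p , W'⊆W q)) , rest

  -- Only variables of V are shared.  Since W₁ and W₂ lie in W, a rule renamed
  -- apart from s is also fresh for both parts.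
  record Split (V : List Var) (s s₁ s₂ : State) : Set₁ where
    constructor split
    field
      goals  : goal (proj₂ s) ↭ goal (proj₂ s₁) ++ goal (proj₂ s₂)
      atoms  : users (proj₂ s) ↭ users (proj₂ s₁) ++ users (proj₂ s₂)
      stores : CT ⊨ ⋀ (store (proj₂ s)) ⇔̇ (⋀ (store (proj₂ s₁)) ∧̇ ⋀ (store (proj₂ s₂)))
      fv₁⊆W₁ : fvConfig (proj₂ s₁) ⊆ proj₁ s₁
      fv₂⊆W₂ : fvConfig (proj₂ s₂) ⊆ proj₁ s₂
      W₁⊆W   : proj₁ s₁ ⊆ proj₁ s
      W₂⊆W   : proj₁ s₂ ⊆ proj₁ s
      shared : ∀ {x} → x ∈ proj₁ s₁ → x ∈ proj₁ s₂ → x ∈ V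

  Split-swap : ∀ {V s s₁ s₂} → Split V s s₁ s₂ → Split V s s₂ s₁
  Split-swap {s₁ = _ , ⟨ G₁ , K₁ , _ ⟩} (split gs ks ds f₁ f₂ w₁ w₂ sh) =
    split (↭-trans gs (++-comm G₁ _)) (↭-trans ks (++-comm K₁ _))
      (λ M m v → (λ s → let t₁ , t₂ = proj₁ (ds M m v) s in t₂ , t₁)
               , (λ (t₂ , t₁) → proj₂ (ds M m v) (t₁ , t₂)))
      f₂ f₁ w₂ w₁ (λ p q → sh q p)

  initial-split : ∀ {G A B} → G ↭ A ++ B →
    Split (fvGoal G) (fvGoal G , ⟨ G , [] , [] ⟩)
      (fvGoal A , ⟨ A , [] , [] ⟩) (fvGoal B , ⟨ B , [] , [] ⟩)
  initial-split {G} {A} {B} p =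
    split p ↭-refl (λ M m v → (λ _ → tt , tt) , (λ _ → tt))
      (++-⊆ id λ ()) (++-⊆ id λ ())
      A⊆G (fvGoal-⊆ {G = B} (∈-resp-↭ (↭-sym p) ∘ ∈-++⁺ʳ A)) (λ x∈A _ → A⊆G x∈A)
    where
      A⊆G : fvGoal A ⊆ fvGoal G
      A⊆G = fvGoal-⊆ {G = A} (∈-resp-↭ (↭-sym p) ∘ ∈-++⁺ˡ)

  -- R holds the variables of the renamed rule, if one is applied, and e the
  -- constraints that the step adds to the store.
  Split-advance : ∀ {V W γ W₁ G₁ K₁ d₁ s₂ G' K' d' G₁' K₁'} (R : List Var) (e : Store S) →
    let γ' = ⟨ G' , K' , d' ⟩ ; γ₁' = ⟨ G₁' , K₁' , e ++ d₁ ⟩ in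
    Split V (W , γ) (W₁ , ⟨ G₁ , K₁ , d₁ ⟩) s₂ →
    G' ↭ G₁' ++ goal (proj₂ s₂) →
    K' ↭ K₁' ++ users (proj₂ s₂) →
    CT ⊨ ⋀ (e ++ store γ) ⇔̇ ⋀ d' →
    Disjoint R W →
    fvConfig γ₁' ⊆ R ++ W₁ →
    fvStore e ⊆ fvConfig γ' ++ W →
    Split V (fvConfig γ' ++ W , γ') (fvConfig γ₁' ++ W₁ , γ₁') s₂
  Split-advance {W = W} {W₁ = W₁} {G₁} {K₁} {d₁} {s₂ = s₂} {G'} {K'} {d'} {G₁'} {K₁'} R e
    (split _ _ ds f₁ f₂ w₁ w₂ sh) gs ks eqv fresh fv₁' fve = record
    { goals  = gs
    ; atoms  = ks
    ; stores = λ M m v →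
        (λ s → let t , t'  = Sat-++⁻ M e (proj₂ (eqv M m v) s)
                   t₁ , t₂ = proj₁ (ds M m v) t'
               in Sat-++⁺ M e t t₁ , t₂) ,
        (λ (t , t₂) → let te , t₁ = Sat-++⁻ M e t
                      in proj₁ (eqv M m v) (Sat-++⁺ M e te (proj₂ (ds M m v) (t₁ , t₂))))
    ; fv₁⊆W₁ = ∈-++⁺ˡ
    ; fv₂⊆W₂ = f₂
    ; W₁⊆W   = ++-⊆
        (fvConfig-⊆ {γ = ⟨ G₁' , K₁' , e ++ d₁ ⟩}
          (∈-++⁺ˡ ∘ goal⊆ {γ = γ'} ∘ fvGoal-⊆ {G = G₁'} (∈-resp-↭ (↭-sym gs) ∘ ∈-++⁺ˡ))
          (∈-++⁺ˡ ∘ users⊆ {γ = γ'} ∘ fvUAtoms-⊆ {K = K₁'} (∈-resp-↭ (↭-sym ks) ∘ ∈-++⁺ˡ))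
          -- The new store of the whole is only equivalent to `e ++ store γ`, so variables of `e`
          -- may have vanished from it; `fve` may place them in `W` instead.
          (++-⊆ fve (∈-++⁺ʳ (fvConfig γ') ∘ w₁ ∘ f₁ ∘ store⊆ {γ = ⟨ G₁ , K₁ , d₁ ⟩})
            ∘ fvStore-++ e))
        (∈-++⁺ʳ (fvConfig γ') ∘ w₁)
    ; W₂⊆W   = ∈-++⁺ʳ (fvConfig γ') ∘ w₂
    -- A variable new to the first component comes from `R`, so it avoids `W` and with it the second
    -- component.
    ; shared = λ x∈W₁' x∈W₂ →
        [ (λ x∈R → ⊥-elim (fresh (x∈R , w₂ x∈W₂))) , (λ x∈W₁ → sh x∈W₁ x∈W₂) ]′
          (∈-++⁻ R (++-⊆ fv₁' (∈-++⁺ʳ R) x∈W₁'))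
    }
    where γ' = ⟨ G' , K' , d' ⟩

  -- The guard cannot depend on the other component. Given `v` satisfying `d₁`, solve `d` by some
  -- `w` equal to `v` on `V`, and let `u` be `v` on the variables of the rule and the first
  -- component and `w` elsewhere. Then `u` satisfies `d₁` as `v` does and the other store as `w`
  -- does, hence `d` and the guard; the guard sees only variables on which `u` is `v`.
  guard-local : ∀ {V W G K d W₁ G₁ K₁ d₁ s₂} R xs φ →
    Split V (W , ⟨ G , K , d ⟩) (W₁ , ⟨ G₁ , K₁ , d₁ ⟩) s₂ → Solvable V d →
    Disjoint R W → fvFormula φ ⊆ R ++ W₁ →
    CT ⊨ ⋀ d ⇒̇ ∃* xs φ → CT ⊨ ⋀ d₁ ⇒̇ ∃* xs φ
  guard-local {W₁ = W₁} {G₁} {K₁} {d₁} {s₂} R xs φ (split _ _ ds f₁ f₂ w₁ w₂ sh) sol fresh fvφ entails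
    M m v t₁ with w , v≡w , t ← sol M m v =
    Sat-∃*-cong M xs φ (override-∈ M L v w ∘ fvφ)
      (entails M m u (proj₂ (ds M m u)
        ( Sat-cong M (⋀ d₁) (sym ∘ override-∈ M L v w ∘ ∈-++⁺ʳ R ∘ f₁ ∘ store⊆ {γ = ⟨ G₁ , K₁ , d₁ ⟩}) t₁
        , Sat-cong M (⋀ (store (proj₂ s₂)))
            (sym ∘ override-agree M L v w agree ∘ f₂ ∘ store⊆ {γ = proj₂ s₂})
            (proj₂ (proj₁ (ds M m w) t)))))
    where
      -- The guard also speaks of the renamed rule, hence `R`. The second component meets `L` only
      -- inside `V`, where `v` and `w` coincide.
      L = R ++ W₁
      u = override M L v w
      agree : ∀ {x} → x ∈ proj₁ s₂ → x ∈ L → v x ≡ w x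
      agree x∈W₂ x∈L with ∈-++⁻ R x∈L
      ... | inj₁ x∈R  = ⊥-elim (fresh (x∈R , w₂ x∈W₂))
      ... | inj₂ x∈W₁ = v≡w (sh x∈W₁ x∈W₂)

  -- Replaying a step in one component.

  Advance : List Var → State → State → State → Set₁
  Advance V s' s₁ s₂ = ∃[ s₁' ] (s₁ ↠ s₁') × Split V s' s₁' s₂

  advance-solve : ∀ {V W G G' K d d' c s₁ s₂} →
    Split V (W , ⟨ G , K , d ⟩) s₁ s₂ →
    builtin c ∈ goal (proj₂ s₁) → G ↭ builtin c ∷ G' →
    CT ⊨ (⌊ c ⌋ ∧̇ ⋀ d) ⇔̇ ⋀ d' →
    Advance V (fvConfig ⟨ G' , K , d' ⟩ ++ W , ⟨ G' , K , d' ⟩) s₁ s₂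
  advance-solve {W = W} {G' = G'} {K} {d' = d'} {c} {W₁ , ⟨ G₁ , K₁ , d₁ ⟩} {_ , ⟨ G₂ , _ , _ ⟩} sp c∈G₁ p eqv
    with G₁' , q , r ← remove-left G₂ c∈G₁ (↭-trans (↭-sym (Split.goals sp)) p) =
    -- The component takes `c ∷ d₁` itself as its new store, so its own equivalence is trivial;
    -- `eqv` relates the store of the whole to it.
    _ , step (solve q (λ M m v → id , id)) ,
    Split-advance [] (c ∷ []) sp r (Split.atoms sp) eqv (λ ())
      (fvConfig-⊆ {γ = ⟨ G₁' , K₁ , c ∷ d₁ ⟩}
        (fv₁⊆W₁ ∘ goal⊆ {γ = γ₁} ∘ fvGoal-⊆ (∈-resp-↭ (↭-sym q) ∘ there))
        (fv₁⊆W₁ ∘ users⊆ {γ = γ₁})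
        (++-⊆ fvc (fv₁⊆W₁ ∘ store⊆ {γ = γ₁})))
      (++-⊆ (∈-++⁺ʳ (fvConfig ⟨ G' , K , d' ⟩) ∘ W₁⊆W ∘ fvc) λ ())
    where
      open Split sp
      γ₁ = ⟨ G₁ , K₁ , d₁ ⟩
      fvc : fvFormula ⌊ c ⌋ ⊆ W₁
      fvc = fv₁⊆W₁ ∘ goal⊆ {γ = γ₁} ∘ fvGoal-⊆ {G = _ ∷ []} {G₁} (∈-∷⁺ʳ c∈G₁ λ ()) ∘ ∈-++⁺ˡ

  advance-introduce : ∀ {V W G G' K d h s₁ s₂} →
    Split V (W , ⟨ G , K , d ⟩) s₁ s₂ →
    user h ∈ goal (proj₂ s₁) → G ↭ user h ∷ G' →
    Advance V (fvConfig ⟨ G' , h ∷ K , d ⟩ ++ W , ⟨ G' , h ∷ K , d ⟩) s₁ s₂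
  advance-introduce {h = h} {W₁ , ⟨ G₁ , K₁ , d₁ ⟩} {_ , ⟨ G₂ , _ , _ ⟩} sp h∈G₁ p
    with G₁' , q , r ← remove-left G₂ h∈G₁ (↭-trans (↭-sym (Split.goals sp)) p) =
    _ , step (introduce q) ,
    Split-advance [] [] sp r (prep h (Split.atoms sp)) (λ M m v → id , id) (λ ())
      (fvConfig-⊆ {γ = ⟨ G₁' , h ∷ K₁ , d₁ ⟩}
        (fv₁⊆W₁ ∘ goal⊆ {γ = γ₁} ∘ fvGoal-⊆ (∈-resp-↭ (↭-sym q) ∘ there))
        (++-⊆ fvh (fv₁⊆W₁ ∘ users⊆ {γ = γ₁}))
        (fv₁⊆W₁ ∘ store⊆ {γ = γ₁}))
      λ ()
    where
      open Split sp
      γ₁ = ⟨ G₁ , K₁ , d₁ ⟩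
      fvh : fvUAtom h ⊆ W₁
      fvh = fv₁⊆W₁ ∘ goal⊆ {γ = γ₁} ∘ fvGoal-⊆ {G = _ ∷ []} {G₁} (∈-∷⁺ʳ h∈G₁ λ ()) ∘ ∈-++⁺ˡ

  fv-kept : ∀ k H' → fvUAtoms (kept k H') ⊆ fvUAtoms H'
  fv-kept propagation H' x∈ = x∈

  -- A head of one atom is matched within one component. The instance, fresh for the whole, is fresh
  -- there too, and `guard-local` transfers the guard.
  advance-apply : ∀ {V W G K K' d k h E C B a s₁ s₂} →
    Split V (W , ⟨ G , K , d ⟩) s₁ s₂ → Solvable V d →
    Instance CT P W k (h ∷ []) C B →
    a ∈ users (proj₂ s₁) → K ↭ a ∷ K' →
    (h ∷ []) ≗ (a ∷ []) ↝ E →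
    CT ⊨ ⋀ d ⇒̇ ∃* (fvUAtoms (h ∷ [])) (⋀ (E ++ C)) →
    let γ' = ⟨ B ++ G , kept k (a ∷ []) ++ K' , E ++ d ⟩ in
    Advance V (fvConfig γ' ++ W , γ') s₁ s₂
  advance-apply {W = W} {G} {K' = K'} {d} {k} {h} {E} {C} {B} {a}
    {W₁ , ⟨ G₁ , K₁ , d₁ ⟩} {_ , ⟨ G₂ , K₂ , d₂ ⟩}
    sp sol inst@(r , σ , _ , _ , fresh , refl , head≡ , refl , refl) a∈K₁ p eq entails
    with K₁' , q , q' ← remove-left K₂ a∈K₁ (↭-trans (↭-sym (Split.atoms sp)) p) =
    _ , step (apply (weaken W₁⊆W inst) q eq
          (guard-local R (fvUAtoms (h ∷ [])) (⋀ (E ++ C)) sp sol fresh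
            (++-⊆ fvE (∈-++⁺ˡ ∘ guard⊆R) ∘ fvStore-++ E) entails)) ,
    Split-advance {d' = E ++ d} R E sp
      (↭-trans (++-↭ˡ B goals) (↭-sym (++-assoc B G₁ G₂)))
      (↭-trans (++-↭ˡ Q q') (↭-sym (++-assoc Q K₁' K₂)))
      (λ M m v → id , id) fresh
      (fvConfig-⊆ {γ = ⟨ B ++ G₁ , Q ++ K₁' , E ++ d₁ ⟩}
        (++-⊆ (∈-++⁺ˡ ∘ body⊆R) (∈-++⁺ʳ R ∘ fv₁⊆W₁ ∘ goal⊆ {γ = γ₁}) ∘ fvGoal-++ B)
        (++-⊆ (∈-++⁺ʳ R ∘ fva ∘ fv-kept k (a ∷ []))
              (∈-++⁺ʳ R ∘ fv₁⊆W₁ ∘ users⊆ {γ = γ₁} ∘ fvUAtoms-⊆ (∈-resp-↭ (↭-sym q) ∘ there))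
          ∘ fvUAtoms-++ Q)
        (++-⊆ fvE (∈-++⁺ʳ R ∘ fv₁⊆W₁ ∘ store⊆ {γ = γ₁}) ∘ fvStore-++ E))
      (∈-++⁺ˡ ∘ store⊆ {γ = ⟨ B ++ G , Q ++ K' , E ++ d ⟩} ∘ fvStore-++ˡ E)
    where
      open Split sp
      γ₁ = ⟨ G₁ , K₁ , d₁ ⟩
      Q = kept k (a ∷ [])
      R = fvRule (renRule σ r)
      head⊆R : fvUAtoms (h ∷ []) ⊆ R
      head⊆R = subst (λ H → fvUAtoms H ⊆ R) head≡ ∈-++⁺ˡ
      guard⊆R : fvStore C ⊆ R
      guard⊆R = ∈-++⁺ʳ (fvUAtoms (head (renRule σ r))) ∘ ∈-++⁺ˡ
      body⊆R : fvGoal B ⊆ R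
      body⊆R = ∈-++⁺ʳ (fvUAtoms (head (renRule σ r))) ∘ ∈-++⁺ʳ (fvStore C)
      fva : fvUAtoms (a ∷ []) ⊆ W₁
      fva = fv₁⊆W₁ ∘ users⊆ {γ = γ₁} ∘ fvUAtoms-⊆ {K = _ ∷ []} {K₁} (∈-∷⁺ʳ a∈K₁ λ ())
      fvE : fvStore E ⊆ R ++ W₁
      fvE = ++-⊆ (∈-++⁺ˡ ∘ head⊆R) (∈-++⁺ʳ R ∘ fva) ∘ fv-≗ eq

  -- Decomposition of derivations for single-head rules.

  module _ (single : CHR 1 P) where

    single-head : ∀ {W k H C B} → Instance CT P W k H C B → ∃[ h ] H ≡ h ∷ []
    single-head (rule _ (h ∷ []) _ _ , _ , r∈P , _ , _ , _ , refl , _) = _ , refl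
    single-head (rule _ (_ ∷ _ ∷ _) _ _ , _ , r∈P , _) with s≤s () ← All.lookup single r∈P

    step-apply : ∀ {V W G K K' d k H H' E C B s₁ s₂} →
      Split V (W , ⟨ G , K , d ⟩) s₁ s₂ → Solvable V d →
      Instance CT P W k H C B →
      K ↭ H' ++ K' →
      H ≗ H' ↝ E →
      CT ⊨ ⋀ d ⇒̇ ∃* (fvUAtoms H) (⋀ (E ++ C)) →
      let γ' = ⟨ B ++ G , kept k H' ++ K' , E ++ d ⟩ ; s' = fvConfig γ' ++ W , γ' in
      Advance V s' s₁ s₂ ⊎ Advance V s' s₂ s₁
    step-apply {s₁ = _ , ⟨ _ , K₁ , _ ⟩} sp sol inst p eq entails
      with h , refl ← single-head inst with eq
    ... | _ ∷ [] with ∈-++⁻ K₁ (∈-resp-↭ (↭-trans (↭-sym p) (Split.atoms sp)) (here refl))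
    ... | inj₁ a∈ = inj₁ (advance-apply sp sol inst a∈ p eq entails)
    ... | inj₂ a∈ = inj₂ (advance-apply (Split-swap sp) sol inst a∈ p eq entails)

    -- Each step acts on one literal or, heads being single, on one atom; the component owning it
    -- makes the step and is listed first in the result.
    step-split : ∀ {V s s' s₁ s₂} →
      Split V s s₁ s₂ → Solvable V (store (proj₂ s)) → s ↠ s' →
      Advance V s' s₁ s₂ ⊎ Advance V s' s₂ s₁
    step-split {s₁ = _ , ⟨ G₁ , _ , _ ⟩} sp sol (step (solve p eqv))
      with ∈-++⁻ G₁ (∈-resp-↭ (↭-trans (↭-sym p) (Split.goals sp)) (here refl))
    ... | inj₁ c∈ = inj₁ (advance-solve sp c∈ p eqv)
    ... | inj₂ c∈ = inj₂ (advance-solve (Split-swap sp) c∈ p eqv)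
    step-split {s₁ = _ , ⟨ G₁ , _ , _ ⟩} sp sol (step (introduce p))
      with ∈-++⁻ G₁ (∈-resp-↭ (↭-trans (↭-sym p) (Split.goals sp)) (here refl))
    ... | inj₁ h∈ = inj₁ (advance-introduce sp h∈ p)
    ... | inj₂ h∈ = inj₂ (advance-introduce (Split-swap sp) h∈ p)
    step-split sp sol (step (simplify inst p eq entails))  = step-apply sp sol inst p eq entails
    step-split sp sol (step (propagate inst p eq entails)) = step-apply sp sol inst p eq entails

    -- Keeps the steps of the first component from the interleaving. When the whole ends with no
    -- goal and no atoms, so does the component; its store may differ from `d'`.
    derivation-split : ∀ {V s s₁ s₂ W' d'} →
      Split V s s₁ s₂ → Star _↠_ s (W' , ⟨ [] , [] , d' ⟩) → Solvable V d' →
      ∃[ W₁' ] ∃[ d₁' ] Star _↠_ s₁ (W₁' , ⟨ [] , [] , d₁' ⟩)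
    derivation-split {s₁ = _ , ⟨ [] , [] , _ ⟩} sp ε sol = _ , _ , ε
    derivation-split {s₁ = _ , ⟨ _ ∷ _ , _ , _ ⟩} sp ε sol = ⊥-elim (¬x∷xs↭[] (↭-sym (Split.goals sp)))
    derivation-split {s₁ = _ , ⟨ [] , _ ∷ _ , _ ⟩} sp ε sol = ⊥-elim (¬x∷xs↭[] (↭-sym (Split.atoms sp)))
    derivation-split sp (r ◅ rs) sol with step-split sp (solvable-start (r ◅ rs) sol) r
    ... | inj₁ (_ , r₁ , sp') with W₁' , d₁' , rs₁ ← derivation-split sp' rs sol = W₁' , d₁' , r₁ ◅ rs₁
    -- The other component moved: its step is dropped and the swap restores the order.
    ... | inj₂ (_ , _ , sp') = derivation-split (Split-swap sp') rs sol

    -- Validity of the answer enters here: it makes the final store solvable for all values of the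
    -- variables of `G`, which include those shared by `A` and `B`.
    component-answer : ∀ {G A B φ} → G ↭ A ++ B → SA CT P G φ → CT ⊨ φ →
      ∃[ ψ ] SA CT P A ψ
    component-answer {G} p (answer {d = d} derivation _) valid
      with _ , _ , derivation₁ ← derivation-split (initial-split p) derivation
                                   (valid⇒solvable (fvGoal G) d valid) =
      _ , answer derivation₁ empty-final

-- The program p(c,…,c), p(c,…,c) ⇔ true | true

module _ (CT : Theory S) {U : RankedSet} (p : Symbol U)
         (c : Symbol (functions S)) (nullary : arity (functions S) c ≡ 0) where

  constants : ∀ k → Vec (Term S) k
  constants k = Vec.replicate k (fun c (subst (Vec (Term S)) (sym nullary) []))

  -- The argument vector of `c` is a transported `[]`; quantifying over all vectors of a length
  -- equal to 0 lets the equation be matched away.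
  fvTerms-nullary : ∀ {k} → k ≡ 0 → (ts : Vec (Term S) k) → fvTerms ts ≡ []
  fvTerms-nullary refl [] = refl

  evalTerms-nullary : ∀ M {k} → k ≡ 0 → ∀ v (ts us : Vec (Term S) k) →
    evalTerms M v ts ≡ evalTerms M v us
  evalTerms-nullary M refl v [] [] = refl

  fv-constants : ∀ σ k → fvTerms (renTerms σ (constants k)) ≡ []
  fv-constants σ 0         = refl
  fv-constants σ (suc k) = 
    cong₂ _++_ (fvTerms-nullary nullary (renTerms σ (subst (Vec (Term S)) (sym nullary) []))) (fv-constants σ k)

  equations : ∀ {k} → Vec (Term S) k → Vec (Term S) k → Store S
  equations ts us = Vec.toList (Vec.zipWith (λ t u → atom (t ≐ u)) ts us)

  Sat-constants-equations : ∀ M v σ k →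
    Sat M v (⋀ (equations (renTerms σ (constants k)) (constants k)))
  Sat-constants-equations M v σ 0         = tt
  Sat-constants-equations M v σ (suc k) =
    cong (Structure.⟦fun⟧ M c) (evalTerms-nullary M nullary v (renTerms σ ts) ts) ,
    Sat-constants-equations M v σ k
    where ts = subst (Vec (Term S)) (sym nullary) []

  -- Constant arguments make the pair rule closed, and matching it against the pair adds only
  -- equations between a constant and itself.
  ground : UAtom S U
  ground = p · constants (arity U p)

  pairRule : Rule S U
  pairRule = rule simplification (ground ∷ ground ∷ []) [] []

  pairProgram : Program S U
  pairProgram = pairRule ∷ []

  renamed-pairRule-closed : ∀ σ → fvRule (renRule σ pairRule) ≡ []
  renamed-pairRule-closed σ rewrite fv-constants σ (arity U p) = refl

  pairGoal : Goal S U
  pairGoal = user ground ∷ user ground ∷ []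

  pair-answer : ∃[ φ ] SA CT pairProgram pairGoal φ × (CT ⊨ φ)
  pair-answer =
    ∃₋ (fvGoal pairGoal) (⋀ (E ++ [])) ,
    answer
      ( step (introduce ↭-refl)
      ◅ step (introduce ↭-refl)
      ◅ step (simplify {H' = ground ∷ ground ∷ []}
          -- The identity is a fresh renaming, as the rule has no variables.
          (pairRule , id , here refl , id , fresh , refl , refl , refl , refl)
          ↭-refl (p ∷ (p ∷ []))
          (λ M m v _ → Valid-∃* M (fvUAtoms (head (renRule id pairRule))) (⋀ (E ++ [])) (valid M) v))
      ◅ ε)
      (empty-final CT pairProgram) ,
    λ M m → Valid-∃* M (_∖_ {S} (fvStore (E ++ [])) (fvGoal pairGoal)) (⋀ (E ++ [])) (valid M)
    where
      E₁ : Store S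
      E₁ = equations (renTerms id (constants (arity U p))) (constants (arity U p))
      E : Store S
      E = E₁ ++ E₁ ++ []
      valid : ∀ M v → Sat M v (⋀ (E ++ []))
      valid M v = Sat-++⁺ M E (Sat-++⁺ M E₁ s (Sat-++⁺ M E₁ s tt)) tt
        where s = Sat-constants-equations M v id (arity U p)
      fresh : ∀ {W} → Disjoint (fvRule (renRule id pairRule)) W
      fresh (x∈ , _) with () ← subst (_ ∈_) (renamed-pairRule-closed id) x∈

  -- Counting user-defined atoms.

  weight : Literal S U → ℕ
  weight (builtin _) = 0
  weight (user _)    = 1

  atomCount : Config S U → ℕ
  atomCount ⟨ G , K , _ ⟩ = sum (map weight G) + length K

  -- Solving a built-in and introducing an atom preserve the count, and the only rule needs two
  -- atoms in the store. A lone atom therefore never disappears.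
  pair-step-count : ∀ {W γ γ'} → Step CT pairProgram W γ γ' →
    atomCount γ ≡ 1 → atomCount γ' ≡ 1
  pair-step-count {γ = ⟨ _ , K , _ ⟩} (solve q _) n =
    trans (cong (_+ length K) (sym (sum-↭ (map-↭ weight q)))) n
  pair-step-count {γ = ⟨ _ , K , _ ⟩} (introduce {G' = G'} q) n =
    trans (+-suc (sum (map weight G')) (length K))
      (trans (cong (_+ length K) (sym (sum-↭ (map-↭ weight q)))) n)
  pair-step-count {γ = ⟨ G , K , _ ⟩}
    (simplify (_ , _ , here refl , _ , _ , _ , refl , _) q (_ ∷ (_ ∷ [])) _) n
    with () ← trans (sym n) (trans (cong (sum (map weight G) +_) (↭-length q))
                (trans (+-suc (sum (map weight G)) _) (cong suc (+-suc (sum (map weight G)) _))))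
  pair-step-count (propagate (_ , _ , here refl , _ , _ , () , _) _ _ _) n

  pair-derivation-count : ∀ {s s'} → Star (_⟶_ CT pairProgram) s s' →
    atomCount (proj₂ s) ≡ 1 → atomCount (proj₂ s') ≡ 1
  pair-derivation-count ε             n = n
  pair-derivation-count (step r ◅ rs) n = pair-derivation-count rs (pair-step-count r n)

  singleton-unanswered : ∀ {φ} → ¬ SA CT pairProgram (user ground ∷ []) φ
  singleton-unanswered (answer derivation _) with () ← pair-derivation-count derivation refl

  pair-nontrivial : ∀ {φ} → ¬ Trivial CT pairGoal φ
  pair-nontrivial (cs , q , _) = user∉ cs (∈-resp-↭ q (here refl))
    where
      user∉ : ∀ cs → user ground ∉ map builtin cs
      user∉ (_ ∷ cs) (there i) = user∉ cs i

theorem4p3 : ∀ {g} (S : Signature) (CT : Theory S) (U V : RankedSet) →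
    (∃[ c ] arity (functions S) c ≡ 0) →
    (∃[ f ] 0 < arity (functions S) f) →
    Symbol U →
    (𝒢 : Pred (Goal S U) g) →
    (∀ (r : Rule S U) (K : List (UAtom S U)) → K ⊑ head r → 𝒢 (map user K)) →
    (n : ℕ) → 2 ≤ n →
    ¬ AcceptableEncoding CT {U} {V} (CHRᵈ CT n) (CHR 1) 𝒢
theorem4p3 S CT U V (c , nullary) _ p 𝒢 closed n 2≤n enc =
  let open AcceptableEncoding enc
      atom₁            = ground CT {U} p c nullary
      r                = pairRule CT {U} p c nullary
      φ , sa , valid   = pair-answer CT {U} p c nullary
      -- Membership in `CHRᵈ CT n`: the only head has two atoms, and no answer to a goal with
      -- user-defined atoms is trivial.
      P                = pairProgram CT {U} p c nullary , (2≤n ∷ []) ,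
                         pairGoal CT {U} p c nullary , φ , sa , pair-nontrivial CT {U} p c nullary {φ}
      _ , saᴱ , φ⇔ψ    = proj₁ (answers P (closed r (atom₁ ∷ atom₁ ∷ []) ([] , ↭-refl))) sa
      -- The encoded pair is the union of two copies of the encoded atom, and its answer `saᴱ` is
      -- valid because it is equivalent to `φ`.
      _ , saᴱ₁         = component-answer CT (proj₁ ⟦ P ⟧) (proj₂ ⟦ P ⟧)
                           (compositional (user atom₁ ∷ []) (user atom₁ ∷ []))
                           saᴱ (λ M m v → proj₁ (φ⇔ψ M m v) (valid M m v))
      -- Equality of answers, now read from the encoding back to the source, gives the lone atom an
      -- answer that it cannot have.
      _ , sa₁ , _      = proj₂ (answers P (closed r (atom₁ ∷ []) (atom₁ ∷ [] , ↭-refl))) saᴱ₁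
  in singleton-unanswered CT {U} p c nullary sa₁
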